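{- Let $(\Omega,\{R_i\}_{i=0}^m)$ be a symmetric association scheme on triples of order $v=|\Omega|$ with intersection numbers $p_{abc}^\ell$ and adjacency matrices $A_0,\dots,A_m$, and let $I\subseteq\{0,1,\dots,m\}$ be a nonempty subset with either $\{1,2,3\}\subseteq I$ or $I\cap\{1,2,3\}=\emptyset$. Then the $v\times v\times v$ array $A=\sum_{i\in I}A_i$ is a $\mathcal{C}^3_3(v,k,\lambda)$-cube, where $$k=\sum_{a,b\in I}\sum_{c=0}^m\big(p_{abc}^0+(v-1)p_{abc}^3\big),\qquad \lambda=\sum_{a,b\in I}\sum_{c,\ell=0}^m p_{abc}^\ell\, n_\ell .$$
   Context: Association scheme on triples (AST): let $\Omega$ be a nonempty finite set, $m\ge 4$, and $\{R_0,\dots,R_m\}$ a partition of $\Omega^3$ into nonempty sets. For a permutation $\sigma$ of $\{1,2,3\}$ put $\sigma(R_i)=\{(x_{\sigma(1)},x_{\sigma(2)},x_{\sigma(3)})\mid (x_1,x_2,x_3)\in R_i\}$. The pair $(\Omega,\{R_i\}_{i=0}^m)$ is an AST of order $|\Omega|$ if: (I) $R_0=\{(x,x,x)\}$, $R_1=\{(x,y,y)\mid x\ne y\}$, $R_2=\{(x,y,x)\mid x\neq y\}$, $R_3=\{(x,x,y)\mid x\ne y\}$ (with $x,y\in\Omega$); (II) for every $i$ and $\sigma$, $\sigma(R_i)=R_j$ for some $j$; (III) for distinct $y,z\in\Omega$ and every $i$, $|\{x\in\Omega\mid (x,y,z)\in R_i\}|$ depends only on $i$; (IV) for all $a,b,c,\ell\in\{0,\dots,m\}$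 and $(x,y,z)\in R_\ell$, the number $|\{w\in\Omega\mid (w,y,z)\in R_a,\ (x,w,z)\in R_b,\ (x,y,w)\in R_c\}|$ depends only on $a,b,c,\ell$; it is the intersection number $p_{abc}^\ell$. The AST is symmetric if $\sigma(R_i)=R_i$ for every $i\in\{4,\dots,m\}$ and every permutation $\sigma$ of $\{1,2,3\}$. Put $n_\ell=|\{z\in\Omega\mid (x,y,z)\in R_\ell\}|$ for distinct $x,y\in\Omega$ (independent of the choice of $x\ne y$; in particular $n_0=n_3=0$ and $n_1=n_2=1$). The adjacency matrix $A_i$ is the $v\times v\times v$ array indexed by $\Omega$ with $A_i(x,y,z)=1$ if $(x,y,z)\in R_i$ and $0$ otherwise. For a $v\times v\times v$ array indexed by $\Omega$, a layer is obtained by fixing one of the three coordinates; two layers are parallel if they fix the same coordinate, to different values; their scalar product is the sum over all positions of the product of corresponding entries. A $\mathcal{C}^3_3(v,k,\lambda)$-cube is a $v\times v\times v$ array over $\{0,1\}$ such that every layer (in each of the three directions) contains exactly $k$ ones and every two parallel layers have scalar product $\lambda$. -}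

module Defs where

open import Data.Bool.Base using (if_then_else_)
open import Data.Fin.Base using (Fin; inject≤; toℕ)
open import Data.Fin.Patterns using (0F; 1F; 2F; 3F)
open import Data.Fin.Permutation using (Permutation′; _⟨$⟩ʳ_; transpose)
open import Data.Fin.Properties using (_≟_)
open import Data.Fin.Subset as Subset using (Subset)
open import Data.Fin.Subset.Properties using (_∈?_)
open import Data.Nat.Base using (ℕ; suc; _*_; _≤_)
import Data.Nat.Properties as ℕ
open import Data.Product using (∃; ∃₂; ∃!; _×_; _,_; proj₁)
open import Data.Sum.Base using (_⊎_)
open import Data.Vec.Base using (Vec; []; _∷_; lookup; tabulate)
open import Function.Base using (_∘_)
open import Function.Bundles using (_↔_; _⇔_; mk⇔; Inverse)
open import Level using (0ℓ)
open import Relation.Binary.PropositionalEquality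
  using (_≡_; _≢_; refl; sym; trans; cong; subst)
open import Relation.Nullary.Decidable using (Dec; does; does-⇔; map′; _×-dec_)
open import Relation.Unary using (Pred; _∈_; _≐_; Decidable)

open import Algebra.Properties.CommutativeMonoid.Sum ℕ.+-0-commutativeMonoid
  using (sum-syntax; sum-cong-≗)

------------------------------------------------------------------------
-- Triples

Triple : Set → Set
Triple Ω = Vec Ω 3

pattern ⟨_,_,_⟩ x y z = x ∷ y ∷ z ∷ []

permute : ∀ {Ω} → Permutation′ 3 → Triple Ω → Triple Ω
permute σ t = tabulate λ i → lookup t (σ ⟨$⟩ʳ i)

permuteRel : ∀ {Ω} → Permutation′ 3 → Pred (Triple Ω) 0ℓ → Pred (Triple Ω) 0ℓ
permuteRel σ R t = ∃ λ s → s ∈ R × t ≡ permute σ s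

------------------------------------------------------------------------
-- Counting and summing

⟦_⟧ : ∀ {P : Set} → Dec P → ℕ
⟦ P? ⟧ = if does P? then 1 else 0

infixl 10 sumOver

sumOver : ∀ {n} → Subset n → (Fin n → ℕ) → ℕ
sumOver {n} I f = ∑[ i < n ] (if does (i ∈? I) then f i else 0)

syntax sumOver I (λ i → e) = ∑[ i ∈ I ] e

-- A finite set Ω of order v is presented by a bijection with Fin v.
module Finite {Ω : Set} {v : ℕ} (enum : Fin v ↔ Ω) where

  infixl 10 sumΩ

  sumΩ : (Ω → ℕ) → ℕ
  sumΩ f = ∑[ i < v ] f (Inverse.to enum i)

  syntax sumΩ (λ x → e) = ∑Ω[ x ] e

  card : ∀ {P : Pred Ω 0ℓ} → Decidable P → ℕ
  card P? = ∑Ω[ x ] ⟦ P? x ⟧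

  card-cong : ∀ {P Q : Pred Ω 0ℓ} (P? : Decidable P) (Q? : Decidable Q) →
              (∀ x → P x ⇔ Q x) → card P? ≡ card Q?
  card-cong P? Q? P⇔Q = sum-cong-≗ λ i →
    let x = Inverse.to enum i in
    cong (if_then 1 else 0) (does-⇔ (P⇔Q x) (P? x) (Q? x))

------------------------------------------------------------------------
-- Cubes

module Cube {Ω : Set} {v : ℕ} (enum : Fin v ↔ Ω) where
  open Finite enum

  Array³ Array² : Set
  Array³ = Ω → Ω → Ω → ℕ
  Array² = Ω → Ω → ℕ

  layer : Fin 3 → Ω → Array³ → Array²
  layer 0F u A = λ y z → A u y z
  layer 1F u A = λ x z → A x u z
  layer 2F u A = λ x y → A x y u

  ones : Array² → ℕ
  ones L = ∑Ω[ x ] ∑Ω[ y ] ⟦ L x y ℕ.≟ 1 ⟧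

  _·_ : Array² → Array² → ℕ
  L · M = ∑Ω[ x ] ∑Ω[ y ] (L x y * M x y)

  -- A is a 𝒞³₃(v,k,λ)-cube, where v is the order of Ω.
  record Is𝒞³₃ (k l : ℕ) (A : Array³) : Set where
    field
      binary       : ∀ x y z → A x y z ≡ 0 ⊎ A x y z ≡ 1
      layer-ones   : ∀ d u → ones (layer d u A) ≡ k
      layer-scalar : ∀ d {u w} → u ≢ w → layer d u A · layer d w A ≡ l

------------------------------------------------------------------------
-- Association schemes on triples

unique-dec : ∀ {n} {P : Pred (Fin n) 0ℓ} → ∃! _≡_ P → Decidable P
unique-dec {P = P} (j , Pj , unique) i =
  map′ (λ j≡i → subst P j≡i Pj) unique (j ≟ i)

record AST {Ω : Set} {v : ℕ} (enum : Fin v ↔ Ω) (m : ℕ) : Set₁ where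
  open Finite enum

  field
    Ω-nonempty : Ω
    4≤m        : 4 ≤ m
    R          : Fin (suc m) → Pred (Triple Ω) 0ℓ
    partition  : ∀ t → ∃! _≡_ λ i → t ∈ R i
    R-nonempty : ∀ i → ∃ λ t → t ∈ R i

  R? : ∀ i → Decidable (R i)
  R? i t = unique-dec (partition t) i

  small : Fin 4 → Fin (suc m)
  small i = inject≤ i (ℕ.m≤n⇒m≤1+n 4≤m)

  #0 = small 0F
  #1 = small 1F
  #2 = small 2F
  #3 = small 3F

  field
    R₀ : R #0 ≐ λ t → ∃ λ x → t ≡ ⟨ x , x , x ⟩
    R₁ : R #1 ≐ λ t → ∃₂ λ x y → x ≢ y × t ≡ ⟨ x , y , y ⟩
    R₂ : R #2 ≐ λ t → ∃₂ λ x y → x ≢ y × t ≡ ⟨ x , y , x ⟩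
    R₃ : R #3 ≐ λ t → ∃₂ λ x y → x ≢ y × t ≡ ⟨ x , x , y ⟩

    permuted : ∀ i σ → ∃ λ j → permuteRel σ (R i) ≐ R j

    regular : ∀ i {y z y′ z′} → y ≢ z → y′ ≢ z′ →
              card (λ x → R? i ⟨ x , y , z ⟩) ≡ card (λ x → R? i ⟨ x , y′ , z′ ⟩)

  triangle? : ∀ a b c x y z w →
    Dec (⟨ w , y , z ⟩ ∈ R a × ⟨ x , w , z ⟩ ∈ R b × ⟨ x , y , w ⟩ ∈ R c)
  triangle? a b c x y z w =
    R? a ⟨ w , y , z ⟩ ×-dec R? b ⟨ x , w , z ⟩ ×-dec R? c ⟨ x , y , w ⟩

  -- p a b c ℓ is the intersection number with lower indices a b c and upper
  -- index ℓ; it is uniquely determined because every R ℓ is nonempty.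
  field
    p      : (a b c ℓ : Fin (suc m)) → ℕ
    p-spec : ∀ a b c ℓ {x y z} → ⟨ x , y , z ⟩ ∈ R ℓ →
             card (triangle? a b c x y z) ≡ p a b c ℓ

  distinctPair : ∃₂ λ (x y : Ω) → x ≢ y
  distinctPair with _ , t∈R₃ ← R-nonempty #3
               with x , y , x≢y , _ ← proj₁ R₃ t∈R₃ = x , y , x≢y

  -- n is computed at one chosen pair of distinct points; n-spec shows that it
  -- does not depend on the choice.
  n : Fin (suc m) → ℕ
  n ℓ = let x , y , _ = distinctPair in card λ z → R? ℓ ⟨ x , y , z ⟩

  private
    reversed : ∀ ℓ x y → card (λ z → R? ℓ ⟨ x , y , z ⟩) ≡
               card (λ z → R? (proj₁ (permuted ℓ (transpose 0F 2F))) ⟨ z , y , x ⟩)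
    reversed ℓ x y with permuted ℓ (transpose 0F 2F)
    ... | j , to , from =
      card-cong (λ z → R? ℓ ⟨ x , y , z ⟩) (λ z → R? j ⟨ z , y , x ⟩)
        λ z → mk⇔ (λ r → to (_ , r , refl)) (back z)
      where
      back : ∀ z → ⟨ z , y , x ⟩ ∈ R j → ⟨ x , y , z ⟩ ∈ R ℓ
      back z r with ⟨ _ , _ , _ ⟩ , s , refl ← from r = s

  n-spec : ∀ ℓ {x y} → x ≢ y → card (λ z → R? ℓ ⟨ x , y , z ⟩) ≡ n ℓ
  n-spec ℓ {x} {y} x≢y =
    let x₀ , y₀ , x₀≢y₀ = distinctPair in
    trans (reversed ℓ x y)
      (trans (regular _ (x≢y ∘ sym) (x₀≢y₀ ∘ sym)) (sym (reversed ℓ x₀ y₀)))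

  adjacency : Fin (suc m) → Cube.Array³ enum
  adjacency i x y z = ⟦ R? i ⟨ x , y , z ⟩ ⟧

  Symmetric : Set
  Symmetric = ∀ i → 4 ≤ toℕ i → ∀ σ → permuteRel σ (R i) ≐ R i

  #123 : Subset (suc m)
  #123 = Subset.⁅ #1 ⁆ Subset.∪ Subset.⁅ #2 ⁆ Subset.∪ Subset.⁅ #3 ⁆

{-# OPTIONS --safe #-}

-- Write χ for the array A, viewed as a function of triples.  The hypothesis on I
-- and the symmetry of the scheme make χ invariant under all permutations of the
-- coordinates, so it suffices to treat the layers χ u · · .  Summing the p a b c ℓ
-- over a, b ∈ I and all c counts, for (x,y,z) ∈ R ℓ, the points w with
-- χ w y z = χ x w z = 1; this is ∑_w χ w y z · χ x w z.  For y = z = x this is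
-- ∑_w χ x w x and for (u,u,y) it is ∑_w χ u w y, and summing over the third
-- coordinate yields k.  Weighting by n ℓ and summing over ℓ amounts to summing
-- over z with x ≠ y fixed, which yields λ.

module Submission where

open import Defs
open import Data.Bool.Base using (true; false; if_then_else_)
open import Data.Fin.Base using (Fin; zero; suc; toℕ; fromℕ<; inject≤; punchIn)
open import Data.Fin.Patterns using (0F; 1F; 2F; 3F)
open import Data.Fin.Permutation using (transpose)
open import Data.Fin.Properties
  using (_≟_; toℕ-injective; toℕ-inject≤; toℕ-fromℕ<; punchInᵢ≢i)
open import Data.Fin.Subset using (Subset; Nonempty; Empty; _⊆_; _∩_; ⁅_⁆)
import Data.Fin.Subset as Subset
open import Data.Fin.Subset.Properties
  using (_∈?_; x∈⁅x⁆; x∈p∪q⁺; x∈p∩q⁺)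
open import Data.Nat.Base using (ℕ; zero; suc; _+_; _*_; _∸_; _≤_)
import Data.Nat.Properties as ℕ
open import Data.Nat.Properties using (+-0-commutativeMonoid)
open import Data.Product using (_,_; proj₁; proj₂)
open import Data.Sum.Base using (_⊎_; inj₁; inj₂)
open import Function.Base using (_∘_)
open import Function.Bundles using (_↔_; Inverse)
open import Relation.Binary.PropositionalEquality
  using (_≡_; _≢_; refl; sym; trans; cong; cong₂; subst; module ≡-Reasoning)
open import Relation.Nullary.Decidable
  using (Dec; does; dec-true; dec-false; _×-dec_)
open import Algebra.Properties.CommutativeMonoid.Sum +-0-commutativeMonoid
  using (sum; sum-syntax; sum-cong-≗; sum-replicate-zero; sum-remove; ∑-distrib-+; ∑-comm)
open import Algebra.Properties.Semiring.Sum ℕ.+-*-semiring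
  using (*-distribˡ-sum; *-distribʳ-sum)

open ≡-Reasoning

-- Indicators and sums over `Fin n`.

⟦⟧-× : ∀ {P Q : Set} (P? : Dec P) (Q? : Dec Q) → ⟦ P? ×-dec Q? ⟧ ≡ ⟦ P? ⟧ * ⟦ Q? ⟧
⟦⟧-× P? Q? with does P? | does Q?
... | true  | true  = refl
... | true  | false = refl
... | false | _     = refl

⟦⟧-binary : ∀ {P : Set} (P? : Dec P) → ⟦ P? ⟧ ≡ 0 ⊎ ⟦ P? ⟧ ≡ 1
⟦⟧-binary P? with does P?
... | true  = inj₂ refl
... | false = inj₁ refl

⟦⟧-idem : ∀ {P : Set} (P? : Dec P) → ⟦ P? ⟧ * ⟦ P? ⟧ ≡ ⟦ P? ⟧
⟦⟧-idem P? with does P?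
... | true  = refl
... | false = refl

-- `ones` tests entries against 1; on a 0/1 entry the test returns the entry itself, so counting
-- ones becomes summation.
⟦⟧-≟1 : ∀ {P : Set} (P? : Dec P) → ⟦ ⟦ P? ⟧ ℕ.≟ 1 ⟧ ≡ ⟦ P? ⟧
⟦⟧-≟1 P? with does P?
... | true  = refl
... | false = refl

sum-const : ∀ {n c} (f : Fin n → ℕ) → (∀ i → f i ≡ c) → sum f ≡ n * c
sum-const {zero}  f f≡c = refl
sum-const {suc n} f f≡c = cong₂ _+_ (f≡c zero) (sum-const (f ∘ suc) (f≡c ∘ suc))

-- Serves the sum over the third coordinate, where a single point behaves differently. As `j`
-- exists, `n` is a successor and `n ∸ 1` is not truncated.
sum-const-off : ∀ {n c} (f : Fin n → ℕ) (j : Fin n) → (∀ i → i ≢ j → f i ≡ c) →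
                sum f ≡ f j + (n ∸ 1) * c
sum-const-off {suc n} f j f≡c = trans (sum-remove {i = j} f)
  (cong (f j +_) (sum-const (f ∘ punchIn j) λ i → f≡c _ (punchInᵢ≢i j i)))

sum-sift : ∀ {n} (j : Fin n) (f : Fin n → ℕ) → ∑[ i < n ] (⟦ j ≟ i ⟧ * f i) ≡ f j
sum-sift {suc n} zero f = begin
  f zero + 0 + ∑[ i < n ] 0  ≡⟨ cong (f zero + 0 +_) (sum-replicate-zero n) ⟩
  f zero + 0 + 0             ≡⟨ ℕ.+-identityʳ _ ⟩
  f zero + 0                 ≡⟨ ℕ.+-identityʳ _ ⟩
  f zero                     ∎
-- The term at `zero` vanishes and `⟦ suc j ≟ suc i ⟧` reduces to `⟦ j ≟ i ⟧`, both by computation.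
sum-sift {suc n} (suc j) f = sum-sift j (f ∘ suc)

-- Sums with indices restricted to `I`.

module _ {n} (I : Subset n) where

  private
    restrict : (Fin n → ℕ) → Fin n → ℕ
    restrict f i = if does (i ∈? I) then f i else 0

  sumOver-cong : ∀ {f g : Fin n → ℕ} → (∀ i → f i ≡ g i) → sumOver I f ≡ sumOver I g
  sumOver-cong f≗g = sum-cong-≗ λ i → cong (if does (i ∈? I) then_else 0) (f≗g i)

  sumOver-+ : ∀ (f g : Fin n → ℕ) →
              ∑[ i ∈ I ] (f i + g i) ≡ sumOver I f + sumOver I g
  sumOver-+ f g = trans (sum-cong-≗ λ i → if-+ (does (i ∈? I)) (f i) (g i))
    (∑-distrib-+ (restrict f) (restrict g))
    where
    if-+ : ∀ b x y → (if b then x + y else 0) ≡ (if b then x else 0) + (if b then y else 0)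
    if-+ true  x y = refl
    if-+ false x y = refl

  sumOver-*ʳ : ∀ (f : Fin n → ℕ) r → ∑[ i ∈ I ] (f i * r) ≡ sumOver I f * r
  sumOver-*ʳ f r =
    trans (sum-cong-≗ λ i → if-* (does (i ∈? I)) (f i)) (sym (*-distribʳ-sum r (restrict f)))
    where
    if-* : ∀ b x → (if b then x * r else 0) ≡ (if b then x else 0) * r
    if-* true  x = refl
    if-* false x = refl

  sumOver-*ˡ : ∀ r (f : Fin n → ℕ) → ∑[ i ∈ I ] (r * f i) ≡ r * sumOver I f
  sumOver-*ˡ r f = begin
    ∑[ i ∈ I ] (r * f i)  ≡⟨ sumOver-cong (λ i → ℕ.*-comm r (f i)) ⟩
    ∑[ i ∈ I ] (f i * r)  ≡⟨ sumOver-*ʳ f r ⟩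
    sumOver I f * r       ≡⟨ ℕ.*-comm _ r ⟩
    r * sumOver I f       ∎

  sumOver-∑ : ∀ {v} (f : Fin n → Fin v → ℕ) →
              ∑[ i ∈ I ] ∑[ w < v ] f i w ≡ ∑[ w < v ] ∑[ i ∈ I ] f i w
  sumOver-∑ {v} f = trans (sum-cong-≗ λ i → if-∑ (does (i ∈? I)) (f i))
    (∑-comm λ i w → restrict (λ j → f j w) i)
    where
    if-∑ : ∀ b (g : Fin v → ℕ) →
           (if b then sum g else 0) ≡ ∑[ w < v ] (if b then g w else 0)
    if-∑ true  g = refl
    if-∑ false g = sym (sum-replicate-zero v)

  -- Rewriting the restriction to `I` as a factor `⟦ i ∈? I ⟧` makes this an instance of `sum-sift`.
  sumOver-⟦≟⟧ : ∀ j → ∑[ i ∈ I ] ⟦ j ≟ i ⟧ ≡ ⟦ j ∈? I ⟧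
  sumOver-⟦≟⟧ j =
    trans (sum-cong-≗ λ i → if-⟦⟧ (does (i ∈? I)) ⟦ j ≟ i ⟧) (sum-sift j λ i → ⟦ i ∈? I ⟧)
    where
    if-⟦⟧ : ∀ b x → (if b then x else 0) ≡ x * (if b then 1 else 0)
    if-⟦⟧ true  x = sym (ℕ.*-identityʳ x)
    if-⟦⟧ false x = sym (ℕ.*-zeroʳ x)

  sumLower : (Fin n → Fin n → Fin n → ℕ) → ℕ
  sumLower f = ∑[ a ∈ I ] ∑[ b ∈ I ] ∑[ c < n ] f a b c

  sumLower-cong : ∀ {f g : Fin n → Fin n → Fin n → ℕ} →
                  (∀ a b c → f a b c ≡ g a b c) → sumLower f ≡ sumLower g
  sumLower-cong f≗g = sumOver-cong λ a → sumOver-cong λ b → sum-cong-≗ λ c → f≗g a b c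

  sumLower-+ : ∀ f g → sumLower (λ a b c → f a b c + g a b c) ≡ sumLower f + sumLower g
  sumLower-+ f g = trans
    (sumOver-cong λ a → trans
      (sumOver-cong λ b → ∑-distrib-+ (f a b) (g a b))
      (sumOver-+ _ _))
    (sumOver-+ _ _)

  sumLower-*ʳ : ∀ f r → sumLower (λ a b c → f a b c * r) ≡ sumLower f * r
  sumLower-*ʳ f r = trans
    (sumOver-cong λ a → trans
      (sumOver-cong λ b → sym (*-distribʳ-sum r (f a b)))
      (sumOver-*ʳ _ r))
    (sumOver-*ʳ _ r)

  sumLower-*ˡ : ∀ r f → sumLower (λ a b c → r * f a b c) ≡ r * sumLower f
  sumLower-*ˡ r f = trans
    (sumOver-cong λ a → trans
      (sumOver-cong λ b → sym (*-distribˡ-sum r (f a b)))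
      (sumOver-*ˡ r _))
    (sumOver-*ˡ r _)

  sumLower-∑ : ∀ {v} (f : Fin n → Fin n → Fin n → Fin v → ℕ) →
               sumLower (λ a b c → ∑[ w < v ] f a b c w) ≡
               ∑[ w < v ] sumLower (λ a b c → f a b c w)
  sumLower-∑ f = trans
    (sumOver-cong λ a → trans
      (sumOver-cong λ b → ∑-comm (f a b))
      (sumOver-∑ λ b w → ∑[ c < n ] f a b c w))
    (sumOver-∑ λ a w → ∑[ b ∈ I ] ∑[ c < n ] f a b c w)

  sumLower-product : ∀ (α β γ : Fin n → ℕ) →
                     sumLower (λ a b c → α a * (β b * γ c)) ≡
                     sumOver I α * (sumOver I β * sum γ)
  sumLower-product α β γ = begin
    ∑[ a ∈ I ] ∑[ b ∈ I ] ∑[ c < n ] (α a * (β b * γ c))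
      ≡⟨ sumOver-cong (λ a → sumOver-cong λ b →
           trans (sym (*-distribˡ-sum (α a) λ c → β b * γ c)) (cong (α a *_) (sym (*-distribˡ-sum (β b) γ)))) ⟩
    ∑[ a ∈ I ] ∑[ b ∈ I ] (α a * (β b * sum γ))
      ≡⟨ sumOver-cong (λ a → trans (sumOver-*ˡ (α a) _) (cong (α a *_) (sumOver-*ʳ β (sum γ)))) ⟩
    ∑[ a ∈ I ] (α a * (sumOver I β * sum γ))
      ≡⟨ sumOver-*ʳ α _ ⟩
    sumOver I α * (sumOver I β * sum γ)
      ∎

  -- Meant for `i`, `j`, `k` the classes of the three triples of a triangle. Since `c` runs over all
  -- indices, its factor sums to 1 and leaves no condition on `k`.
  sumLower-⟦≟⟧ : ∀ i j k → sumLower (λ a b c → ⟦ i ≟ a ⟧ * (⟦ j ≟ b ⟧ * ⟦ k ≟ c ⟧)) ≡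
                 ⟦ i ∈? I ⟧ * ⟦ j ∈? I ⟧
  sumLower-⟦≟⟧ i j k = begin
    sumLower (λ a b c → ⟦ i ≟ a ⟧ * (⟦ j ≟ b ⟧ * ⟦ k ≟ c ⟧))
      ≡⟨ sumLower-product (λ a → ⟦ i ≟ a ⟧) (λ b → ⟦ j ≟ b ⟧) (λ c → ⟦ k ≟ c ⟧) ⟩
    (∑[ a ∈ I ] ⟦ i ≟ a ⟧) * ((∑[ b ∈ I ] ⟦ j ≟ b ⟧) * (∑[ c < n ] ⟦ k ≟ c ⟧))
      ≡⟨ cong₂ _*_ (sumOver-⟦≟⟧ i) (cong₂ _*_ (sumOver-⟦≟⟧ j) total) ⟩
    ⟦ i ∈? I ⟧ * (⟦ j ∈? I ⟧ * 1)
      ≡⟨ cong (⟦ i ∈? I ⟧ *_) (ℕ.*-identityʳ _) ⟩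
    ⟦ i ∈? I ⟧ * ⟦ j ∈? I ⟧
      ∎
    where
    total : ∑[ c < n ] ⟦ k ≟ c ⟧ ≡ 1
    total = trans (sum-cong-≗ λ c → sym (ℕ.*-identityʳ ⟦ k ≟ c ⟧)) (sum-sift k λ _ → 1)

-- The array as an indicator, and triangle counts.

module Union {Ω : Set} {v m : ℕ} (enum : Fin v ↔ Ω) (X : AST enum m)
             (I : Subset (suc m)) where
  open AST X
  open Finite enum

  class : Triple Ω → Fin (suc m)
  class t = proj₁ (partition t)

  class-unique : ∀ {i t} → R i t → class t ≡ i
  class-unique {t = t} = proj₂ (proj₂ (partition t))

  χ? : ∀ x y z → Dec (class ⟨ x , y , z ⟩ Subset.∈ I)
  χ? x y z = class ⟨ x , y , z ⟩ ∈? I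

  χ : Ω → Ω → Ω → ℕ
  χ x y z = ⟦ χ? x y z ⟧

  χ-class : ∀ {i x y z} → R i ⟨ x , y , z ⟩ → χ x y z ≡ ⟦ i ∈? I ⟧
  χ-class r = cong (λ i → ⟦ i ∈? I ⟧) (class-unique r)

  -- `R? i t` is `class t ≟ i` transported by `map′`, so `adjacency i x y z` reduces to
  -- `⟦ class ⟨ x , y , z ⟩ ≟ i ⟧`.
  sum-adjacency : ∀ x y z → ∑[ i ∈ I ] adjacency i x y z ≡ χ x y z
  sum-adjacency x y z = sumOver-⟦≟⟧ I (class ⟨ x , y , z ⟩)

  -- Double counting: each `w` forms a triangle for exactly one choice of `a`, `b`, `c`, namely the
  -- classes of its three triples, and is counted when the first two lie in `I`.
  sumLower-p : ∀ {ℓ x y z} → R ℓ ⟨ x , y , z ⟩ →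
               sumLower I (λ a b c → p a b c ℓ) ≡ ∑Ω[ w ] (χ w y z * χ x w z)
  sumLower-p {ℓ} {x} {y} {z} r = begin
    sumLower I (λ a b c → p a b c ℓ)
      ≡⟨ sumLower-cong I (λ a b c → sym (p-spec a b c ℓ r)) ⟩
    sumLower I (λ a b c → ∑Ω[ w ] ⟦ triangle? a b c x y z w ⟧)
      ≡⟨ sumLower-∑ I (λ a b c i → ⟦ triangle? a b c x y z (Inverse.to enum i) ⟧) ⟩
    ∑Ω[ w ] sumLower I (λ a b c → ⟦ triangle? a b c x y z w ⟧)
      ≡⟨ sum-cong-≗ (λ i → at (Inverse.to enum i)) ⟩
    ∑Ω[ w ] (χ w y z * χ x w z)
      ∎
    where
    at : ∀ w → sumLower I (λ a b c → ⟦ triangle? a b c x y z w ⟧) ≡ χ w y z * χ x w z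
    at w = trans
      (sumLower-cong I λ a b c → trans
        (⟦⟧-× (R? a ⟨ w , y , z ⟩) (R? b ⟨ x , w , z ⟩ ×-dec R? c ⟨ x , y , w ⟩))
        (cong (⟦ R? a ⟨ w , y , z ⟩ ⟧ *_)
          (⟦⟧-× (R? b ⟨ x , w , z ⟩) (R? c ⟨ x , y , w ⟩))))
      (sumLower-⟦≟⟧ I (class ⟨ w , y , z ⟩) (class ⟨ x , w , z ⟩) (class ⟨ x , y , w ⟩))

-- Invariance of `χ` under permutations of the coordinates.

data SmallOrLarge {n} (4≤n : 4 ≤ n) : Fin n → Set where
  small : ∀ j → SmallOrLarge 4≤n (inject≤ j 4≤n)
  large : ∀ {i} → 4 ≤ toℕ i → SmallOrLarge 4≤n i

smallOrLarge : ∀ {n} (4≤n : 4 ≤ n) i → SmallOrLarge 4≤n i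
smallOrLarge 4≤n i with ℕ.<-≤-connex (toℕ i) 4
... | inj₂ 4≤i = large 4≤i
... | inj₁ i<4 = subst (SmallOrLarge 4≤n)
  (toℕ-injective (trans (toℕ-inject≤ _ 4≤n) (toℕ-fromℕ< i<4)))
  (small (fromℕ< i<4))

module Symmetry {Ω : Set} {v m : ℕ} (enum : Fin v ↔ Ω) (X : AST enum m)
                (symmetric : AST.Symmetric X) (I : Subset (suc m))
                (closed : AST.#123 X ⊆ I ⊎ Empty (I ∩ AST.#123 X)) where
  open AST X renaming (small to embed)
  open Finite enum
  open Union enum X I

  private
    -- The common value of `χ` on `R #1`, `R #2` and `R #3`: by `closed`, either all three indices
    -- lie in `I` or none does.
    κ : ℕ
    κ = ⟦ #1 ∈? I ⟧

    ⟦∈I⟧-#123 : ∀ {i j} → i Subset.∈ #123 → j Subset.∈ #123 → ⟦ i ∈? I ⟧ ≡ ⟦ j ∈? I ⟧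
    ⟦∈I⟧-#123 {i} {j} i∈ j∈ = cong (if_then 1 else 0) (go closed)
      where
      go : #123 ⊆ I ⊎ Empty (I ∩ #123) → does (i ∈? I) ≡ does (j ∈? I)
      go (inj₁ ⊆I) = trans (dec-true (i ∈? I) (⊆I i∈)) (sym (dec-true (j ∈? I) (⊆I j∈)))
      go (inj₂ ∅)  = trans (dec-false (i ∈? I) λ i∈I → ∅ (i , x∈p∩q⁺ (i∈I , i∈)))
                      (sym (dec-false (j ∈? I) λ j∈I → ∅ (j , x∈p∩q⁺ (j∈I , j∈))))

    #1∈ : #1 Subset.∈ #123
    #1∈ = x∈p∪q⁺ (inj₁ (x∈⁅x⁆ #1))

    #2∈ : #2 Subset.∈ #123
    #2∈ = x∈p∪q⁺ {p = ⁅ #1 ⁆} (inj₂ (x∈p∪q⁺ (inj₁ (x∈⁅x⁆ #2))))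

    #3∈ : #3 Subset.∈ #123
    #3∈ = x∈p∪q⁺ {p = ⁅ #1 ⁆} (inj₂ (x∈p∪q⁺ {p = ⁅ #2 ⁆} (inj₂ (x∈⁅x⁆ #3))))

    χ-xyy : ∀ {x y} → x ≢ y → χ x y y ≡ κ
    χ-xyy x≢y = χ-class (proj₂ R₁ (_ , _ , x≢y , refl))

    χ-xyx : ∀ {x y} → x ≢ y → χ x y x ≡ κ
    χ-xyx x≢y = trans (χ-class (proj₂ R₂ (_ , _ , x≢y , refl))) (⟦∈I⟧-#123 #2∈ #1∈)

    χ-xxy : ∀ {x y} → x ≢ y → χ x x y ≡ κ
    χ-xxy x≢y = trans (χ-class (proj₂ R₃ (_ , _ , x≢y , refl))) (⟦∈I⟧-#123 #3∈ #1∈)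

    χ-large : ∀ {i t} → 4 ≤ toℕ i → R i t → ∀ σ → class t ≡ class (permute σ t)
    χ-large 4≤i r σ =
      trans (class-unique r) (sym (class-unique (proj₁ (symmetric _ 4≤i σ) (_ , r , refl))))

  -- Classes below 4 are explicit: the swap fixes the triples of `R #0` and `R #3` and exchanges
  -- `R #1` with `R #2`, where `χ` is `κ`. The remaining classes are covered by `symmetric`.
  χ-swap₁₂ : ∀ x y z → χ x y z ≡ χ y x z
  χ-swap₁₂ x y z = go (smallOrLarge _ (class ⟨ x , y , z ⟩)) (proj₁ (proj₂ (partition _)))
    where
    -- The index is generalised to a variable so that matching on `SmallOrLarge` can replace it by
    -- one of `#0` to `#3`.
    go : ∀ {i} → SmallOrLarge (ℕ.m≤n⇒m≤1+n 4≤m) i → R i ⟨ x , y , z ⟩ → χ x y z ≡ χ y x z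
    go (small 0F) r with _ , refl ← proj₁ R₀ r = refl
    go (small 1F) r with _ , _ , x≢y , refl ← proj₁ R₁ r =
      trans (χ-xyy x≢y) (sym (χ-xyx (x≢y ∘ sym)))
    go (small 2F) r with _ , _ , x≢y , refl ← proj₁ R₂ r =
      trans (χ-xyx x≢y) (sym (χ-xyy (x≢y ∘ sym)))
    go (small 3F) r with _ , _ , _   , refl ← proj₁ R₃ r = refl
    go (large 4≤i) r = cong (λ i → ⟦ i ∈? I ⟧) (χ-large 4≤i r (transpose 0F 1F))

  -- Now `R #2` and `R #3` are exchanged, while the triples of `R #0` and `R #1` are fixed.
  χ-swap₂₃ : ∀ x y z → χ x y z ≡ χ x z y
  χ-swap₂₃ x y z = go (smallOrLarge _ (class ⟨ x , y , z ⟩)) (proj₁ (proj₂ (partition _)))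
    where
    go : ∀ {i} → SmallOrLarge (ℕ.m≤n⇒m≤1+n 4≤m) i → R i ⟨ x , y , z ⟩ → χ x y z ≡ χ x z y
    go (small 0F) r with _ , refl ← proj₁ R₀ r = refl
    go (small 1F) r with _ , _ , _   , refl ← proj₁ R₁ r = refl
    go (small 2F) r with _ , _ , x≢y , refl ← proj₁ R₂ r =
      trans (χ-xyx x≢y) (sym (χ-xxy x≢y))
    go (small 3F) r with _ , _ , x≢y , refl ← proj₁ R₃ r =
      trans (χ-xxy x≢y) (sym (χ-xyx x≢y))
    go (large 4≤i) r = cong (λ i → ⟦ i ∈? I ⟧) (χ-large 4≤i r (transpose 1F 2F))

  -- Layer sums and scalar products.

  open Cube enum

  -- Moving `u` to the front keeps `x` and `y` in order, so layers in all three directions reduce to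
  -- those fixing the first coordinate.
  layer-χ : ∀ {A : Array³} → (∀ x y z → A x y z ≡ χ x y z) →
            ∀ d u x y → layer d u A x y ≡ χ u x y
  layer-χ A≗χ 0F u x y = A≗χ u x y
  layer-χ A≗χ 1F u x y = trans (A≗χ x u y) (χ-swap₁₂ x u y)
  layer-χ A≗χ 2F u x y = trans (A≗χ x y u) (trans (χ-swap₂₃ x y u) (χ-swap₁₂ x u y))

  ΣΩ-cong : ∀ {f g : Ω → ℕ} → (∀ x → f x ≡ g x) → sumΩ f ≡ sumΩ g
  ΣΩ-cong f≗g = sum-cong-≗ λ i → f≗g (Inverse.to enum i)

  ∑∑χ : ∀ u → ∑Ω[ x ] ∑Ω[ y ] χ u x y ≡
        sumLower I (λ a b c → p a b c #0 + (v ∸ 1) * p a b c #3)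
  ∑∑χ u = begin
    ∑Ω[ x ] ∑Ω[ y ] χ u x y
      -- With `y` outermost, the triple `⟨ u , u , y ⟩` stays fixed while the inner variable plays
      -- the role of `w` in `sumLower-p`.
      ≡⟨ ∑-comm (λ i j → χ u (Inverse.to enum i) (Inverse.to enum j)) ⟩
    ∑Ω[ y ] ∑Ω[ x ] χ u x y
      -- An indicator equals its square; swapping coordinates in one factor yields the product that
      -- `sumLower-p` expects.
      ≡⟨ ΣΩ-cong (λ y → ΣΩ-cong λ x → sym (trans
           (cong (_* χ u x y) (χ-swap₁₂ x u y)) (⟦⟧-idem (χ? u x y)))) ⟩
    ∑Ω[ y ] ∑Ω[ x ] (χ x u y * χ u x y)
      -- The triple lies in `R #0` for `y = u`, at index `i₀`, and in `R #3` at the other `v ∸ 1`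
      -- points.
      ≡⟨ sum-const-off (λ i → ∑Ω[ x ] (χ x u (Inverse.to enum i) * χ u x (Inverse.to enum i)))
           i₀ off ⟩
    ∑Ω[ x ] (χ x u (Inverse.to enum i₀) * χ u x (Inverse.to enum i₀)) + (v ∸ 1) * S #3
      ≡⟨ cong (_+ (v ∸ 1) * S #3) (sym (sumLower-p (proj₂ R₀
           (u , cong (λ y → ⟨ u , u , y ⟩) to-i₀)))) ⟩
    S #0 + (v ∸ 1) * S #3
      ≡⟨ cong (S #0 +_) (sym (sumLower-*ˡ I (v ∸ 1) (λ a b c → p a b c #3))) ⟩
    S #0 + sumLower I (λ a b c → (v ∸ 1) * p a b c #3)
      ≡⟨ sym (sumLower-+ I (λ a b c → p a b c #0) (λ a b c → (v ∸ 1) * p a b c #3)) ⟩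
    sumLower I (λ a b c → p a b c #0 + (v ∸ 1) * p a b c #3)
      ∎
    where
    S : Fin (suc m) → ℕ
    S ℓ = sumLower I (λ a b c → p a b c ℓ)

    i₀ : Fin v
    i₀ = Inverse.from enum u

    to-i₀ : Inverse.to enum i₀ ≡ u
    to-i₀ = Inverse.strictlyInverseˡ enum u

    off : ∀ i → i ≢ i₀ →
          ∑Ω[ x ] (χ x u (Inverse.to enum i) * χ u x (Inverse.to enum i)) ≡ S #3
    off i i≢i₀ = sym (sumLower-p (proj₂ R₃ (u , Inverse.to enum i , u≢ , refl)))
      where
      u≢ : u ≢ Inverse.to enum i
      u≢ u≡ = i≢i₀ (sym (Inverse.inverseʳ enum u≡))

  ∑∑χχ : ∀ {u w} → u ≢ w → ∑Ω[ x ] ∑Ω[ y ] (χ u x y * χ w x y) ≡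
         sumLower I (λ a b c → ∑[ ℓ < suc m ] (p a b c ℓ * n ℓ))
  ∑∑χχ {u} {w} u≢w = begin
    ∑Ω[ x ] ∑Ω[ y ] (χ u x y * χ w x y)
      ≡⟨ ∑-comm (λ i j → χ u (Inverse.to enum i) (Inverse.to enum j)
                        * χ w (Inverse.to enum i) (Inverse.to enum j)) ⟩
    ∑Ω[ z ] ∑Ω[ x ] (χ u x z * χ w x z)
      -- Brings the product to the form of `sumLower-p` for the triple `⟨ u , w , z ⟩`.
      ≡⟨ ΣΩ-cong (λ z → ΣΩ-cong λ x → trans
           (ℕ.*-comm (χ u x z) (χ w x z)) (cong (_* χ u x z) (χ-swap₁₂ w x z))) ⟩
    ∑Ω[ z ] ∑Ω[ x ] (χ x w z * χ u x z)
      ≡⟨ ΣΩ-cong (λ z → sym (sumLower-p (proj₁ (proj₂ (partition ⟨ u , w , z ⟩))))) ⟩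
    ∑Ω[ z ] S (class ⟨ u , w , z ⟩)
      -- `sum-sift` read backwards sorts the points `z` by class; `⟦ class ⟨ u , w , z ⟩ ≟ ℓ ⟧` is
      -- `⟦ R? ℓ ⟨ u , w , z ⟩ ⟧` by computation.
      ≡⟨ ΣΩ-cong (λ z → trans (sym (sum-sift (class ⟨ u , w , z ⟩) S))
           (sum-cong-≗ λ ℓ → ℕ.*-comm ⟦ R? ℓ ⟨ u , w , z ⟩ ⟧ (S ℓ))) ⟩
    ∑Ω[ z ] ∑[ ℓ < suc m ] (S ℓ * ⟦ R? ℓ ⟨ u , w , z ⟩ ⟧)
      ≡⟨ ∑-comm (λ i ℓ → S ℓ * ⟦ R? ℓ ⟨ u , w , Inverse.to enum i ⟩ ⟧) ⟩
    ∑[ ℓ < suc m ] ∑Ω[ z ] (S ℓ * ⟦ R? ℓ ⟨ u , w , z ⟩ ⟧)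
      -- As `u ≢ w`, exactly `n ℓ` points `z` fall into the class `ℓ`.
      ≡⟨ sum-cong-≗ (λ ℓ → trans
           (sym (*-distribˡ-sum (S ℓ) (λ i → ⟦ R? ℓ ⟨ u , w , Inverse.to enum i ⟩ ⟧)))
           (cong (S ℓ *_) (n-spec ℓ u≢w))) ⟩
    ∑[ ℓ < suc m ] (S ℓ * n ℓ)
      ≡⟨ sum-cong-≗ (λ ℓ → sym (sumLower-*ʳ I (λ a b c → p a b c ℓ) (n ℓ))) ⟩
    ∑[ ℓ < suc m ] sumLower I (λ a b c → p a b c ℓ * n ℓ)
      ≡⟨ sym (sumLower-∑ I (λ a b c ℓ → p a b c ℓ * n ℓ)) ⟩
    sumLower I (λ a b c → ∑[ ℓ < suc m ] (p a b c ℓ * n ℓ))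
      ∎
    where
    S : Fin (suc m) → ℕ
    S ℓ = sumLower I (λ a b c → p a b c ℓ)

theorem4p15 : ∀ {Ω : Set} {v m : ℕ} (enum : Fin v ↔ Ω) (X : AST enum m) →
    let open AST X in
    Symmetric →
    (I : Subset (suc m)) → Nonempty I → (#123 ⊆ I ⊎ Empty (I ∩ #123)) →
    Cube.Is𝒞³₃ enum
    (∑[ a ∈ I ] ∑[ b ∈ I ] ∑[ c < suc m ] (p a b c #0 + (v ∸ 1) * p a b c #3))
    (∑[ a ∈ I ] ∑[ b ∈ I ] ∑[ c < suc m ] ∑[ ℓ < suc m ] (p a b c ℓ * n ℓ))
    (λ x y z → ∑[ i ∈ I ] adjacency i x y z)
theorem4p15 enum X symmetric I _ closed = record
  { binary       = λ x y z →
      subst (λ k → k ≡ 0 ⊎ k ≡ 1) (sym (sum-adjacency x y z)) (⟦⟧-binary (χ? x y z))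
  ; layer-ones   = λ d u → trans
      (ΣΩ-cong λ x → ΣΩ-cong λ y → trans
        (cong (λ k → ⟦ k ℕ.≟ 1 ⟧) (layer-χ sum-adjacency d u x y))
        (⟦⟧-≟1 (χ? u x y)))
      (∑∑χ u)
  ; layer-scalar = λ d {u} {w} u≢w → trans
      (ΣΩ-cong λ x → ΣΩ-cong λ y →
        cong₂ _*_ (layer-χ sum-adjacency d u x y) (layer-χ sum-adjacency d w x y))
      (∑∑χχ u≢w)
  }
  where
  open Union enum X I
  open Symmetry enum X symmetric I closed
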